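{- Let $\Delta\ge 4$ and let $G$ be a finite simple graph in which every node has degree at most $\Delta$. Then the matching $M$ returned by MinGreedy on $G$ satisfies $|M|\ge \frac{2\Delta-1}{4\Delta-4}\,\nu(G)$ for every outcome of its random choices.
   Context: $\nu(G)$ denotes the size of a maximum matching of $G$. MinGreedy maintains a current graph (initially $G$) and a matching $M$ (initially empty); while the current graph has an edge, it chooses a node $u$ uniformly at random among the non-isolated nodes of minimum degree in the current graph, chooses a neighbor $v$ of $u$ in the current graph uniformly at random, adds $\{u,v\}$ to $M$, and deletes $u$, $v$ and all their incident edges. -}

module Defs where

open import Data.Nat using (ℕ; _≤_; _<_)
open import Data.Bool using (Bool; true; false; _∧_; not)
open import Data.Fin using (Fin; _≟_)
open import Data.List using (List; []; _∷_; length; allFin; filterᵇ)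
open import Data.List.Relation.Unary.All using (All)
open import Data.List.Relation.Unary.AllPairs using (AllPairs)
open import Data.Product using (_×_; _,_; ∃-syntax)
open import Relation.Binary.PropositionalEquality using (_≡_)
open import Relation.Nullary using (¬_)
open import Relation.Nullary.Decidable using (⌊_⌋)

record Graph (n : ℕ) : Set where
  field
    adj    : Fin n → Fin n → Bool
    sym    : ∀ u v → adj u v ≡ adj v u
    irrefl : ∀ u → adj u u ≡ false
open Graph public

-- A vertex subset (the vertices still present in the current graph).
VSet : ℕ → Set
VSet n = Fin n → Bool

allV : ∀ {n} → VSet n
allV _ = true

deg : ∀ {n} → Graph n → VSet n → Fin n → ℕ
deg G S u = length (filterᵇ (λ w → S w ∧ adj G u w) (allFin _))

degree : ∀ {n} → Graph n → Fin n → ℕ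
degree G = deg G allV

MaxDegreeAtMost : ∀ {n} → Graph n → ℕ → Set
MaxDegreeAtMost G Δ = ∀ u → degree G u ≤ Δ

remove : ∀ {n} → VSet n → Fin n → Fin n → VSet n
remove S u v w = S w ∧ not ⌊ w ≟ u ⌋ ∧ not ⌊ w ≟ v ⌋

HasEdge : ∀ {n} → Graph n → VSet n → Set
HasEdge G S = ∃[ u ] ∃[ v ] (S u ≡ true × S v ≡ true × adj G u v ≡ true)

MinDegNonIsolated : ∀ {n} → Graph n → VSet n → Fin n → Set
MinDegNonIsolated G S u =
  S u ≡ true × 1 ≤ deg G S u ×
  (∀ w → S w ≡ true → 1 ≤ deg G S w → deg G S u ≤ deg G S w)

-- MinGreedyRun G S M : M is a possible output of MinGreedy started from the
-- current graph G[S] (over all outcomes of the random choices; every choice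
-- with positive probability is allowed).
data MinGreedyRun {n} (G : Graph n) : VSet n → List (Fin n × Fin n) → Set where
  stop : ∀ {S} → ¬ HasEdge G S → MinGreedyRun G S []
  step : ∀ {S M} u v →
         MinDegNonIsolated G S u →
         S v ≡ true → adj G u v ≡ true →
         MinGreedyRun G (remove S u v) M →
         MinGreedyRun G S ((u , v) ∷ M)

Disjoint : ∀ {n} → Fin n × Fin n → Fin n × Fin n → Set
Disjoint (a , b) (c , d) = ¬ a ≡ c × ¬ a ≡ d × ¬ b ≡ c × ¬ b ≡ d

IsMatching : ∀ {n} → Graph n → List (Fin n × Fin n) → Set
IsMatching G N = All (λ e → adj G (Data.Product.proj₁ e) (Data.Product.proj₂ e) ≡ true) N
               × AllPairs Disjoint N

IsMatchingNumber : ∀ {n} → Graph n → ℕ → Set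
IsMatchingNumber G k =
  (∃[ N ] (IsMatching G N × length N ≡ k)) ×
  (∀ N → IsMatching G N → length N ≤ k)

{-# OPTIONS --safe #-}
module Submission where

-- Fix a matching N.  In the current graph S, call a vertex busy if its N-partner is still
-- present, and free otherwise.  A busy vertex weighs 2Δ − 1, a free one 2 · min(deg, 2), and
-- the potential of S is the total weight, plus a bonus 2Δ − 4 if S has a vertex of degree 1.
-- It is at least 2 (2Δ − 1) |N| for S = G and 0 once no edge is left, so it suffices that
-- matching u (of minimum degree) with v costs at most 2 (4Δ − 4).  Besides u and v, the step
-- costs weight only at their busy partners, which become free, and at free vertices whose
-- degree drops to 0 or 1.  If u has degree 1, the latter are neighbours of v, and the bonus may
-- be lost as well.  If u has degree at least 2, there is no bonus to lose; the tight case is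
-- that u and v are both busy with different partners, and then either the step creates a leaf,
-- and the bonus pays for the drops, or no free vertex loses weight.

open import Defs
open import Data.Nat as ℕ using (ℕ; zero; suc; _+_; _≤_; _*_; _∸_; _⊓_; z≤n; s≤s; s≤s⁻¹)
open import Data.Nat.Properties hiding (_≟_)
open import Data.Nat.Tactic.RingSolver using (solve-∀)
open import Data.Bool as Bool using (Bool; true; false; if_then_else_; _∧_)
open import Data.Bool.Properties using (∧-identityʳ; ∧-zeroʳ; ∧-conicalˡ; ∧-conicalʳ; ¬-not)
open import Data.Fin using (Fin; zero; suc; _≟_)
open import Data.Fin.Properties using (any?)
open import Data.List using (List; []; _∷_; length; tabulate; filterᵇ; map)
import Data.Nat.ListAction as ListAction
open import Data.List.Relation.Unary.All as All using (All; []; _∷_)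
open import Data.List.Relation.Unary.All.Properties using (map⁺)
open import Data.List.Relation.Unary.AllPairs using (AllPairs; []; _∷_)
open import Data.List.Relation.Unary.Unique.Propositional using (Unique)
open import Data.List.Membership.Propositional using (_∈_)
open import Data.List.Relation.Unary.Any using (here; there)
open import Data.Product using (_×_; _,_; proj₁; proj₂; ∃)
open import Data.Sum as Sum using (_⊎_; inj₁; inj₂)
open import Function using (_∘_; id)
open import Relation.Nullary using (¬_; Dec; yes; no; contradiction)
open import Relation.Nullary.Decidable using (⌊_⌋; _×-dec_)
open import Relation.Binary.PropositionalEquality
  using (_≡_; _≢_; refl; cong; cong₂; trans; subst; module ≡-Reasoning) renaming (sym to ≡-sym)
open import Algebra.Properties.Semiring.Sum +-*-semiring
  using (sum; ∑-distrib-+; *-distribˡ-sum; sum-cong-≗)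

-- Finite sums and charges placed at single vertices.

bit : Bool → ℕ
bit b = if b then 1 else 0

sum-mono-≤ : ∀ {n} {f g : Fin n → ℕ} → (∀ x → f x ≤ g x) → sum f ≤ sum g
sum-mono-≤ {zero}  f≤g = z≤n
sum-mono-≤ {suc n} f≤g = +-mono-≤ (f≤g zero) (sum-mono-≤ (f≤g ∘ suc))

sum-zero : ∀ n → sum {n} (λ _ → 0) ≡ 0
sum-zero zero    = refl
sum-zero (suc n) = sum-zero n

at : ∀ {n} → Fin n → ℕ → Fin n → ℕ
at a c x = if ⌊ x ≟ a ⌋ then c else 0

at-≡ : ∀ {n} (a : Fin n) c → at a c a ≡ c
at-≡ a c with a ≟ a
... | yes _  = refl
... | no a≢a = contradiction refl a≢a

at-≢ : ∀ {n} {a x : Fin n} c → x ≢ a → at a c x ≡ 0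
at-≢ {a = a} {x} c x≢a with x ≟ a
... | yes x≡a = contradiction x≡a x≢a
... | no _    = refl

at-suc : ∀ {n} (a : Fin n) c x → at (suc a) c (suc x) ≡ at a c x
at-suc a c x with x ≟ a
... | yes _ = refl
... | no _  = refl

sum-at : ∀ {n} (a : Fin n) c → sum (at a c) ≡ c
sum-at {suc n} zero    c = trans (cong (c +_) (sum-zero n)) (+-identityʳ c)
sum-at {suc n} (suc a) c = trans (sum-cong-≗ (at-suc a c)) (sum-at a c)

-- The pairs (a , c) of l stand for the function Σ c · [x = a], which is charge l x below.
Charges : ℕ → Set
Charges n = List (Fin n × ℕ)

charge : ∀ {n} → Charges n → Fin n → ℕ
charge []            x = 0
charge ((a , c) ∷ l) x = at a c x + charge l x

total : ∀ {n} → Charges n → ℕ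
total []            = 0
total ((a , c) ∷ l) = c + total l

sum-charge : ∀ {n} (l : Charges n) → sum (charge l) ≡ total l
sum-charge {n} []            = sum-zero n
sum-charge ((a , c) ∷ l) = trans (∑-distrib-+ (at a c) (charge l)) (cong₂ _+_ (sum-at a c) (sum-charge l))

charge-absent : ∀ {n} (l : Charges n) {x} → All (λ p → x ≢ proj₁ p) l → charge l x ≡ 0
charge-absent []            []           = refl
charge-absent ((a , c) ∷ l) (x≢a ∷ x∉l) = cong₂ _+_ (at-≢ c x≢a) (charge-absent l x∉l)

charge-≥ : ∀ {n} {a : Fin n} {c} (l : Charges n) → (a , c) ∈ l → c ≤ charge l a
charge-≥ {a = a} {c} (_ ∷ l) (here refl)  = ≤-trans (≤-reflexive (≡-sym (at-≡ a c))) (m≤m+n _ _)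
charge-≥         (_ ∷ l) (there a∈l) = ≤-trans (charge-≥ l a∈l) (m≤n+m _ _)

-- Turn the listed values into charges: as `xs` has no repetition, at most one entry charges a given
-- vertex, and it charges the value of `f` there.
sum-distinct-≤ : ∀ {n} (f : Fin n → ℕ) xs → Unique xs → ListAction.sum (map f xs) ≤ sum f
sum-distinct-≤ {n} f xs uniq = begin
  ListAction.sum (map f xs)     ≡⟨ total-map xs ⟨
  total (map entry xs)    ≡⟨ sum-charge (map entry xs) ⟨
  sum (charge (map entry xs)) ≤⟨ sum-mono-≤ (pointwise xs uniq) ⟩
  sum f                   ∎
  where
  open ≤-Reasoning
  entry : Fin n → Fin n × ℕ
  entry a = a , f a
  total-map : ∀ ys → total (map entry ys) ≡ ListAction.sum (map f ys)
  total-map []       = refl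
  total-map (y ∷ ys) = cong (f y +_) (total-map ys)
  pointwise : ∀ ys → Unique ys → ∀ x → charge (map entry ys) x ≤ f x
  pointwise []       []      x = z≤n
  pointwise (y ∷ ys) (p ∷ q) x with x ≟ y
  ... | yes refl = ≤-reflexive (trans (cong (f y +_) (charge-absent (map entry ys) (map⁺ p))) (+-identityʳ (f y)))
  ... | no _     = pointwise ys q x

length-filterᵇ : ∀ {n} {A : Set} (p : A → Bool) (f : Fin n → A) →
  length (filterᵇ p (tabulate f)) ≡ sum (bit ∘ p ∘ f)
length-filterᵇ {zero}  p f = refl
length-filterᵇ {suc n} p f with p (f zero)
... | true  = cong suc (length-filterᵇ p (f ∘ suc))
... | false = length-filterᵇ p (f ∘ suc)

-- Degrees in the current graph as sums of indicators.

module _ {n} (G : Graph n) where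

  link : VSet n → Fin n → Fin n → ℕ
  link S a x = bit (S x ∧ adj G a x)

  deg≡sum : ∀ S a → deg G S a ≡ sum (link S a)
  deg≡sum S a = length-filterᵇ (λ w → S w ∧ adj G a w) id

  -- Used to bound a degree from below by naming distinct neighbours, each of which adds 1.
  links≤deg : ∀ S a xs → Unique xs → ListAction.sum (map (link S a) xs) ≤ deg G S a
  links≤deg S a xs uniq = ≤-trans (sum-distinct-≤ (link S a) xs uniq) (≤-reflexive (≡-sym (deg≡sum S a)))

  -- The indicator sums before and after the removal differ only at `u` and `v`, where `at` restores
  -- the lost link.
  deg-remove : ∀ S {u v} → S u ≡ true → S v ≡ true → u ≢ v → ∀ x →
    deg G S x ≡ deg G (remove S u v) x + (bit (adj G x u) + bit (adj G x v))
  deg-remove S {u} {v} Su Sv u≢v x = begin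
    deg G S x
      ≡⟨ deg≡sum S x ⟩
    sum (link S x)
      ≡⟨ sum-cong-≗ split ⟩
    sum (λ w → link S' x w + (at u X w + at v Y w))
      ≡⟨ ∑-distrib-+ (link S' x) _ ⟩
    sum (link S' x) + sum (λ w → at u X w + at v Y w)
      ≡⟨ cong₂ _+_ (≡-sym (deg≡sum S' x)) (∑-distrib-+ (at u X) (at v Y)) ⟩
    deg G S' x + (sum (at u X) + sum (at v Y))
      ≡⟨ cong (deg G S' x +_) (cong₂ _+_ (sum-at u X) (sum-at v Y)) ⟩
    deg G S' x + (X + Y) ∎
    where
    open ≡-Reasoning
    S' = remove S u v
    X = bit (adj G x u)
    Y = bit (adj G x v)
    split : ∀ w → link S x w ≡ link S' x w + (at u X w + at v Y w)
    split w with w ≟ u | w ≟ v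
    ... | yes refl | yes refl = contradiction refl u≢v
    ... | yes refl | no _     rewrite Su = ≡-sym (+-identityʳ X)
    ... | no _     | yes refl rewrite Sv = refl
    ... | no _     | no _     with S w
    ...   | true  = ≡-sym (+-identityʳ _)
    ...   | false = refl

-- The partner map of a matching.

mateIn : ∀ {n} → List (Fin n × Fin n) → Fin n → Fin n
mateIn []            x = x
mateIn ((a , b) ∷ N) x = if ⌊ x ≟ a ⌋ then b else if ⌊ x ≟ b ⌋ then a else mateIn N x

mateIn-left : ∀ {n} (a b : Fin n) N → mateIn ((a , b) ∷ N) a ≡ b
mateIn-left a b N with a ≟ a
... | yes _  = refl
... | no a≢a = contradiction refl a≢a

mateIn-right : ∀ {n} (a b : Fin n) N → mateIn ((a , b) ∷ N) b ≡ a
mateIn-right a b N with b ≟ a | b ≟ b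
... | yes b≡a | _      = b≡a
... | no _    | yes _  = refl
... | no _    | no b≢b = contradiction refl b≢b

mateIn-tail : ∀ {n} {a b x : Fin n} N → x ≢ a → x ≢ b → mateIn ((a , b) ∷ N) x ≡ mateIn N x
mateIn-tail {a = a} {b} {x} N x≢a x≢b with x ≟ a | x ≟ b
... | yes x≡a | _       = contradiction x≡a x≢a
... | no _    | yes x≡b = contradiction x≡b x≢b
... | no _    | no _    = refl

mateIn-absent : ∀ {n} {x : Fin n} N → All (λ e → x ≢ proj₁ e × x ≢ proj₂ e) N → mateIn N x ≡ x
mateIn-absent []            []                    = refl
mateIn-absent ((a , b) ∷ N) ((x≢a , x≢b) ∷ x∉N) = trans (mateIn-tail N x≢a x≢b) (mateIn-absent N x∉N)

-- When `x` lies outside the first edge, so does its partner in `N`: disjointness makes `mateIn N`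
-- fix both ends of that edge, and a partner equal to such an end would force `x` to be that end.
mateIn-involutive : ∀ {n} (N : List (Fin n × Fin n)) → AllPairs Disjoint N →
  ∀ x → mateIn N (mateIn N x) ≡ x
mateIn-involutive []            []           x = refl
mateIn-involutive ((a , b) ∷ N) (e#N ∷ disj) x with x ≟ a | x ≟ b
... | yes refl | _        = mateIn-right a b N
... | no _     | yes refl = mateIn-left a b N
... | no x≢a   | no x≢b   =
  trans (mateIn-tail N (avoids a∉N x≢a) (avoids b∉N x≢b)) (mateIn-involutive N disj x)
  where
  a∉N = All.map (λ (a≢c , a≢d , _ , _) → a≢c , a≢d) e#N
  b∉N = All.map (λ (_ , _ , b≢c , b≢d) → b≢c , b≢d) e#N
  avoids : ∀ {c} → All (λ e → c ≢ proj₁ e × c ≢ proj₂ e) N → x ≢ c → mateIn N x ≢ c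
  avoids {c} c∉N x≢c m≡c = x≢c (begin
    x                     ≡⟨ mateIn-involutive N disj x ⟨
    mateIn N (mateIn N x) ≡⟨ cong (mateIn N) m≡c ⟩
    mateIn N c            ≡⟨ mateIn-absent N c∉N ⟩
    c                     ∎)
    where open ≡-Reasoning

-- Counting matched vertices.

module _ {n} (G : Graph n) where

  adj⇒≢ : ∀ {x y} → adj G x y ≡ true → x ≢ y
  adj⇒≢ {x} xy refl with trans (≡-sym xy) (irrefl G x)
  ... | ()

  endpoints : List (Fin n × Fin n) → Charges n
  endpoints []            = []
  endpoints ((a , b) ∷ N) = (a , 1) ∷ (b , 1) ∷ endpoints N

  total-endpoints : ∀ N → total (endpoints N) ≡ length N * 2
  total-endpoints []      = refl
  total-endpoints (_ ∷ N) = cong (2 +_) (total-endpoints N)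

  endpoints-absent : ∀ {x} N → All (λ e → x ≢ proj₁ e × x ≢ proj₂ e) N → charge (endpoints N) x ≡ 0
  endpoints-absent []            []                   = refl
  endpoints-absent ((a , b) ∷ N) ((x≢a , x≢b) ∷ x∉N) =
    cong₂ _+_ (at-≢ 1 x≢a) (cong₂ _+_ (at-≢ 1 x≢b) (endpoints-absent N x∉N))

  -- By disjointness an endpoint is charged only once; `mateIn` then sends it across its own edge of
  -- `N`, so the indicator is 1.
  endpoints≤mated : ∀ N → IsMatching G N →
    ∀ x → charge (endpoints N) x ≤ bit (adj G x (mateIn N x))
  endpoints≤mated []            _                           x = z≤n
  endpoints≤mated ((a , b) ∷ N) (ab ∷ edges , e#N ∷ disj) x with x ≟ a | x ≟ b
  ... | yes refl | yes refl = contradiction refl (adj⇒≢ ab)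
  ... | yes refl | no _     rewrite ab =
    ≤-reflexive (cong suc (endpoints-absent N (All.map (λ (p , q , _ , _) → p , q) e#N)))
  ... | no _     | yes refl rewrite trans (Graph.sym G b a) ab =
    ≤-reflexive (cong suc (endpoints-absent N (All.map (λ (_ , _ , p , q) → p , q) e#N)))
  ... | no _     | no _     = endpoints≤mated N (edges , disj) x

  matching≤mated : ∀ N → IsMatching G N → length N * 2 ≤ sum (λ x → bit (adj G x (mateIn N x)))
  matching≤mated N matching = begin
    length N * 2             ≡⟨ total-endpoints N ⟨
    total (endpoints N)      ≡⟨ sum-charge (endpoints N) ⟨
    sum (charge (endpoints N)) ≤⟨ sum-mono-≤ (endpoints≤mated N matching) ⟩
    sum (λ x → bit (adj G x (mateIn N x))) ∎
    where open ≤-Reasoning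

-- In use, `k` and `m` are degrees before and after a step and `n` is the loss charged. The
-- truncation passes to `m` since the left side never exceeds 2.
⊓-+-≤ : ∀ {k m n} → k ⊓ 2 ≤ m + n → k ⊓ 2 ≤ m ⊓ 2 + n
⊓-+-≤ {k} {m} {n} k≤m+n = begin
  k ⊓ 2             ≤⟨ ⊓-glb k≤m+n (≤-trans (m⊓n≤n k 2) (m≤m+n 2 n)) ⟩
  (m + n) ⊓ (2 + n) ≡⟨ +-distribʳ-⊓ n m 2 ⟨
  m ⊓ 2 + n         ∎
  where open ≤-Reasoning

-- Weights of the present vertices.

module Potential {n} (G : Graph n) (mate : Fin n → Fin n)
  (mate-involutive : ∀ x → mate (mate x) ≡ x) (K : ℕ) where

  -- For `mateIn N`, an unmatched vertex is its own mate; the adjacency test fails there, so the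
  -- vertex counts as free.
  busy : VSet n → Fin n → Bool
  busy S x = S (mate x) ∧ adj G x (mate x)

  weight : VSet n → Fin n → ℕ
  weight S x = if S x then (if busy S x then K else 2 * (deg G S x ⊓ 2)) else 0

  total-weight : VSet n → ℕ
  total-weight S = sum (weight S)

  weight-out : ∀ S {x} → S x ≡ false → weight S x ≡ 0
  weight-out S Sx rewrite Sx = refl

  weight-busy : ∀ S {x} → S x ≡ true → busy S x ≡ true → weight S x ≡ K
  weight-busy S Sx bx rewrite Sx | bx = refl

  weight-free : ∀ S {x} → S x ≡ true → busy S x ≡ false → weight S x ≡ 2 * (deg G S x ⊓ 2)
  weight-free S Sx fx rewrite Sx | fx = refl

  weight-free≤4 : ∀ S {x} → S x ≡ true → busy S x ≡ false → weight S x ≤ 4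
  weight-free≤4 S {x} Sx fx = ≤-trans (≤-reflexive (weight-free S Sx fx)) (*-monoʳ-≤ 2 (m⊓n≤n (deg G S x) 2))

  mate-injective : ∀ {x y} → mate x ≡ mate y → x ≡ y
  mate-injective {x} {y} e = trans (≡-sym (mate-involutive x)) (trans (cong mate e) (mate-involutive y))

  mate-swap : ∀ {x y} → mate x ≡ y → x ≡ mate y
  mate-swap refl = ≡-sym (mate-involutive _)

  busy-alive : ∀ S {x} → busy S x ≡ true → S (mate x) ≡ true
  busy-alive S {x} bx = ∧-conicalˡ (S (mate x)) _ bx

  busy-adj : ∀ S {x} → busy S x ≡ true → adj G x (mate x) ≡ true
  busy-adj S {x} bx = ∧-conicalʳ (S (mate x)) _ bx

  busy-mate : ∀ S {x} → S x ≡ true → busy S x ≡ true → busy S (mate x) ≡ true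
  busy-mate S {x} Sx bx rewrite mate-involutive x | Sx = trans (Graph.sym G (mate x) x) (busy-adj S bx)

  -- The mate of a present busy vertex is busy too. Hence deleting a free vertex never deprives a
  -- busy one of its partner.
  mate≢free : ∀ S {x a} → busy S a ≡ false → S x ≡ true → busy S x ≡ true → mate x ≢ a
  mate≢free S fa Sx bx refl with trans (≡-sym (busy-mate S Sx bx)) fa
  ... | ()

  -- Accounting for the deletion of two adjacent vertices.

  module Removal (S : VSet n) {u v : Fin n} (Su : S u ≡ true) (Sv : S v ≡ true)
    (uv : adj G u v ≡ true) where

    S' = remove S u v

    u≢v : u ≢ v
    u≢v = adj⇒≢ G uv

    kept : ∀ {x} → x ≢ u → x ≢ v → S' x ≡ S x
    kept {x} x≢u x≢v with x ≟ u | x ≟ v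
    ... | yes x≡u | _       = contradiction x≡u x≢u
    ... | no _    | yes x≡v = contradiction x≡v x≢v
    ... | no _    | no _    = ∧-identityʳ (S x)

    removedˡ : S' u ≡ false
    removedˡ with u ≟ u
    ... | yes _  = ∧-zeroʳ (S u)
    ... | no u≢u = contradiction refl u≢u

    removedʳ : S' v ≡ false
    removedʳ with v ≟ u | v ≟ v
    ... | yes v≡u | _      = ∧-zeroʳ (S v)
    ... | no _    | yes _  = ∧-zeroʳ (S v)
    ... | no _    | no v≢v = contradiction refl v≢v

    Y X : Fin n → ℕ
    Y = link G S v
    X = link G S u

    link≡1 : ∀ {a x} → S x ≡ true → adj G a x ≡ true → link G S a x ≡ 1
    link≡1 Sx ax rewrite Sx | ax = refl

    Yu≡1 : Y u ≡ 1
    Yu≡1 = link≡1 Su (trans (Graph.sym G v u) uv)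

    Xv≡1 : X v ≡ 1
    Xv≡1 = link≡1 Sv uv

    link-sym : ∀ {x} a → S x ≡ true → bit (adj G x a) ≡ link G S a x
    link-sym {x} a Sx rewrite Sx = cong bit (Graph.sym G x a)

    deg-kept : ∀ {x} → S x ≡ true → deg G S x ≡ deg G S' x + (X x + Y x)
    deg-kept {x} Sx = trans (deg-remove G S Su Sv u≢v x)
      (cong (deg G S' x +_) (cong₂ _+_ (link-sym u Sx) (link-sym v Sx)))

    -- The step costs at x at most 2 · r x + B x − A x, with A moved to the left because ∸ truncates.
    Pays : Charges n → (Fin n → ℕ) → Charges n → Fin n → Set
    Pays A r B x = weight S x + charge A x ≤ weight S' x + 2 * r x + charge B x

    -- A free vertex loses 2 per unit of truncated degree, hence the factor 2. Except where it is 0,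
    -- `r` will count links to `v` and possibly `u`, so that its sum is read off from their degrees.
    balance : ∀ (A B : Charges n) (r : Fin n → ℕ) →
      (∀ x → Pays A r B x) →
      total-weight S + total A ≤ total-weight S' + 2 * sum r + total B
    balance A B r pointwise = begin
      total-weight S + total A
        ≡⟨ cong (total-weight S +_) (sum-charge A) ⟨
      sum (weight S) + sum (charge A)
        ≡⟨ ∑-distrib-+ (weight S) (charge A) ⟨
      sum (λ x → weight S x + charge A x)
        ≤⟨ sum-mono-≤ pointwise ⟩
      sum (λ x → weight S' x + 2 * r x + charge B x)
        ≡⟨ ∑-distrib-+ (λ x → weight S' x + 2 * r x) (charge B) ⟩
      sum (λ x → weight S' x + 2 * r x) + sum (charge B)
        ≡⟨ cong₂ _+_ (∑-distrib-+ (weight S') (λ x → 2 * r x)) (sum-charge B) ⟩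
      sum (weight S') + sum (λ x → 2 * r x) + total B
        ≡⟨ cong (λ s → sum (weight S') + s + total B) (*-distribˡ-sum 2 r) ⟨
      total-weight S' + 2 * sum r + total B ∎
      where open ≤-Reasoning

    sum-links : ∀ κ → sum (λ x → Y x + κ * X x) ≡ deg G S v + κ * deg G S u
    sum-links κ = begin
      sum (λ x → Y x + κ * X x)         ≡⟨ ∑-distrib-+ Y (λ x → κ * X x) ⟩
      sum Y + sum (λ x → κ * X x)       ≡⟨ cong (sum Y +_) (*-distribˡ-sum κ X) ⟨
      sum Y + κ * sum X                 ≡⟨ cong₂ (λ p q → p + κ * q) (deg≡sum G S v) (deg≡sum G S u) ⟨
      deg G S v + κ * deg G S u         ∎
      where open ≡-Reasoning

    -- Reduces the claim at `x` to one inequality between numbers: upper bounds for its weight and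
    -- refund, lower bounds for what remains and what is paid.
    settle : ∀ A r B x {p q w₀ r₀ t₀} → weight S x ≤ p → charge A x ≤ q →
      p + q ≤ w₀ + 2 * r₀ + t₀ →
      w₀ ≤ weight S' x → r₀ ≤ r x → t₀ ≤ charge B x → Pays A r B x
    settle A r B x w≤p a≤q p+q≤ w₀≤w' r₀≤r t₀≤t = ≤-trans (+-mono-≤ w≤p a≤q)
      (≤-trans p+q≤ (+-mono-≤ (+-mono-≤ w₀≤w' (*-monoʳ-≤ 2 r₀≤r)) t₀≤t))

    freed : ∀ {x} → S x ≡ true → x ≢ u → x ≢ v → S' (mate x) ≡ false →
      weight S' x ≡ 2 * (deg G S' x ⊓ 2)
    freed {x} Sx x≢u x≢v dead =
      weight-free S' (trans (kept x≢u x≢v) Sx) (cong (_∧ adj G x (mate x)) dead)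

    Spared : ℕ → Fin n → Set
    Spared b x = deg G S x ⊓ 2 ≤ deg G S' x ⊓ 2 + b

    -- A busy vertex whose mate stays keeps its weight `K`. A free vertex stays free, because no
    -- vertex is added, and loses 2 per unit of truncated degree. An absent vertex weighs nothing.
    persists : ∀ {x b} → x ≢ u → x ≢ v →
      (S x ≡ true → busy S x ≡ true → mate x ≢ u × mate x ≢ v) →
      (S x ≡ true → Spared b x) → weight S x ≤ weight S' x + 2 * b
    persists {x} {b} x≢u x≢v apart spared = go (S x) (busy S x) refl refl
      where
      open ≤-Reasoning
      go : ∀ s t → S x ≡ s → busy S x ≡ t → weight S x ≤ weight S' x + 2 * b
      go false _     Sx _  = subst (_≤ weight S' x + 2 * b) (≡-sym (weight-out S Sx)) z≤n
      go true  true  Sx bx = begin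
        weight S x          ≡⟨ weight-busy S {x} Sx bx ⟩
        K                   ≡⟨ weight-busy S' (trans (kept x≢u x≢v) Sx) still-busy ⟨
        weight S' x         ≤⟨ m≤m+n (weight S' x) (2 * b) ⟩
        weight S' x + 2 * b ∎
        where
        still-busy : busy S' x ≡ true
        still-busy = let mx≢u , mx≢v = apart Sx bx in trans (cong (_∧ adj G x (mate x)) (kept mx≢u mx≢v)) bx
      go true  false Sx fx = begin
        weight S x                   ≡⟨ weight-free S Sx fx ⟩
        2 * (deg G S x ⊓ 2)          ≤⟨ *-monoʳ-≤ 2 (spared Sx) ⟩
        2 * (deg G S' x ⊓ 2 + b)     ≡⟨ *-distribˡ-+ 2 (deg G S' x ⊓ 2) b ⟩
        2 * (deg G S' x ⊓ 2) + 2 * b ≡⟨ cong (_+ 2 * b) (weight-free S' (trans (kept x≢u x≢v) Sx) still-free) ⟨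
        weight S' x + 2 * b          ∎
        where
        still-free : busy S' x ≡ false
        still-free with S (mate x)
        ... | false = refl
        ... | true  rewrite fx = ∧-zeroʳ _

    persists-pays : ∀ A r B {x} → x ≢ u → x ≢ v →
      (S x ≡ true → busy S x ≡ true → mate x ≢ u × mate x ≢ v) →
      (S x ≡ true → Spared (r x) x) → All (λ p → x ≢ proj₁ p) A → Pays A r B x
    persists-pays A r B {x} x≢u x≢v apart spared x∉A =
      settle A r B x (persists x≢u x≢v apart spared) (≤-reflexive (charge-absent A x∉A))
        ≤-refl ≤-refl ≤-refl z≤n

    spare : ∀ b {x} → deg G S x ⊓ 2 ≤ deg G S' x + b → Spared b x
    spare b {x} = ⊓-+-≤ {deg G S x} {deg G S' x}

    -- As `u` and `v` are both free, no busy vertex loses its mate. The 8 pays for these two, at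
    -- most 4 each; every other loss is a drop of truncated degree.
    unmated-balance : ∀ κ → busy S u ≡ false → busy S v ≡ false →
      (∀ x → x ≢ u → x ≢ v → S x ≡ true → Spared (Y x + κ * X x) x) →
      total-weight S + 0 ≤ total-weight S' + 2 * (deg G S v + κ * deg G S u) + 8
    unmated-balance κ fu fv spared =
      subst (λ s → total-weight S + 0 ≤ total-weight S' + 2 * s + 8) (sum-links κ)
        (balance [] B r (λ x → pays x (x ≟ u) (x ≟ v)))
      where
      r : Fin n → ℕ
      r x = Y x + κ * X x
      B = (u , 4) ∷ (v , 4) ∷ []
      pays : ∀ x → Dec (x ≡ u) → Dec (x ≡ v) → Pays [] r B x
      pays x (yes refl) _ = settle [] r B x (weight-free≤4 S Su fu) z≤n
        (≤-refl {4}) z≤n z≤n (charge-≥ B (here refl))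
      pays x (no _) (yes refl) = settle [] r B x (weight-free≤4 S Sv fv) z≤n
        (≤-refl {4}) z≤n z≤n (charge-≥ B (there (here refl)))
      pays x (no x≢u) (no x≢v) = persists-pays [] r B x≢u x≢v
        (λ Sx bx → mate≢free S fu Sx bx , mate≢free S fv Sx bx) (spared x x≢u x≢v) []

    -- The hypothesis on mate u says that u is free or is matched by N to v.  The lemma is used
    -- with (κ , c) = (0 , 0), (1 , 2), (0 , 2) for deg u = 1, deg u = 2, deg u ≥ 3: a free vertex
    -- needs to be charged for its edge to u only in the second case.
    v-mated-balance : ∀ κ c → (busy S u ≡ true → mate u ≡ v) → busy S v ≡ true →
      2 * (deg G S u ⊓ 2) ≤ 2 + c →
      (∀ x → x ≢ u → x ≢ v → S x ≡ true → Spared (Y x + κ * X x) x) →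
      total-weight S + (2 + (2 * κ + 0)) ≤
      total-weight S' + 2 * (deg G S v + κ * deg G S u) + (c + (K + (K + 0)))
    v-mated-balance κ c mu≡v bv u-cheap spared =
      subst (λ s → total-weight S + total A ≤ total-weight S' + 2 * s + total B) (sum-links κ)
        (balance A B r (λ x → pays x (x ≟ v) (x ≟ mv) (x ≟ u)))
      where
      mv = mate v
      r : Fin n → ℕ
      r x = Y x + κ * X x
      -- The sum of `r` also counts the links from `mv` to `v` and from `v` to `u`, although `B`
      -- pays for `mv` and `v` in full; `A` refunds 2 for the former and `2 * κ` for the latter. If
      -- `u` is not `mv`, its own link to `v` contributes 2 towards its weight, leaving `c` to `B`.
      A = (mv , 2) ∷ (v , 2 * κ) ∷ []
      B = (u , c) ∷ (v , K) ∷ (mv , K) ∷ []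
      v≢mv : v ≢ mv
      v≢mv = adj⇒≢ G (busy-adj S bv)
      Smv = busy-alive S bv
      arith-v : ∀ K κ → K + (0 + (2 * κ + 0)) ≡ 0 + 2 * κ + K
      arith-v = solve-∀
      arith-mv : ∀ K → K + 2 ≡ 0 + 2 * 1 + K
      arith-mv = solve-∀
      arith-u : ∀ c → 2 + c + 0 ≡ 0 + 2 * 1 + c
      arith-u = solve-∀
      apart : ∀ {x} → x ≢ v → x ≢ mv → S x ≡ true → busy S x ≡ true → mate x ≢ u × mate x ≢ v
      apart {x} x≢v x≢mv Sx bx = mx≢u , (λ mx≡v → x≢mv (mate-swap mx≡v))
        where
        mx≢u : mate x ≢ u
        mx≢u refl = x≢v (trans (≡-sym (mate-involutive x)) (mu≡v (busy-mate S Sx bx)))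
      pays : ∀ x → Dec (x ≡ v) → Dec (x ≡ mv) → Dec (x ≡ u) → Pays A r B x
      pays x (yes refl) _ _ = settle A r B x
        (≤-reflexive (weight-busy S Sv bv))
        (≤-reflexive (cong₂ _+_ (at-≢ 2 v≢mv) (cong (_+ 0) (at-≡ v (2 * κ)))))
        (≤-reflexive (arith-v K κ))
        z≤n
        (≤-trans (≤-reflexive (trans (≡-sym (*-identityʳ κ)) (cong (κ *_) (≡-sym Xv≡1)))) (m≤n+m _ (Y v)))
        (charge-≥ B (there (here refl)))
      pays x (no x≢v) (yes refl) _ = settle A r B x
        (≤-reflexive (weight-busy S Smv (busy-mate S Sv bv)))
        (≤-reflexive (cong₂ _+_ (at-≡ mv 2) (cong (_+ 0) (at-≢ (2 * κ) x≢v))))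
        (≤-reflexive (arith-mv K))
        z≤n
        (≤-trans (≤-reflexive (≡-sym (link≡1 Smv (busy-adj S bv)))) (m≤m+n _ (κ * X mv)))
        (charge-≥ B (there (there (here refl))))
      pays x (no x≢v) (no x≢mv) (yes refl) = settle A r B x
        (≤-trans (≤-reflexive (weight-free S Su fu)) u-cheap)
        (≤-reflexive (charge-absent A (x≢mv ∷ x≢v ∷ [])))
        (≤-reflexive (arith-u c))
        z≤n
        (≤-trans (≤-reflexive (≡-sym Yu≡1)) (m≤m+n _ (κ * X u)))
        (charge-≥ B (here refl))
        where
        fu : busy S u ≡ false
        fu = ¬-not (λ bu → x≢mv (mate-swap (mu≡v bu)))
      pays x (no x≢v) (no x≢mv) (no x≢u) = persists-pays A r B x≢u x≢v
        (apart x≢v x≢mv) (spared x x≢u x≢v) (x≢mv ∷ x≢v ∷ [])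

    -- The case where `N` matches `u` to a vertex other than `v`.

    module _ (bu : busy S u ≡ true) (mu≢v : mate u ≢ v) where

      mu = mate u

      u≢mu : u ≢ mu
      u≢mu = adj⇒≢ G (busy-adj S bu)

      Smu : S mu ≡ true
      Smu = busy-alive S bu

      Xmu≡1 : X mu ≡ 1
      Xmu≡1 = link≡1 Smu (busy-adj S bu)

      -- `u` and the freed `mu` are charged their full weight `K`, and the free `v` at most 4. The
      -- refund of 2 is the link from `u` to `v`, counted in the degree of `v` although `u` is
      -- already paid for.
      u-mated-balance : busy S v ≡ false →
        (∀ x → x ≢ u → x ≢ v → x ≢ mu → S x ≡ true → Spared (Y x) x) →
        total-weight S + 2 ≤ total-weight S' + 2 * deg G S v + (K + (K + 4))
      u-mated-balance fv spared =
        subst (λ s → total-weight S + total A ≤ total-weight S' + 2 * s + total B) (≡-sym (deg≡sum G S v))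
          (balance A B Y (λ x → pays x (x ≟ u) (x ≟ v) (x ≟ mu)))
        where
        A = (u , 2) ∷ []
        B = (u , K) ∷ (mu , K) ∷ (v , 4) ∷ []
        arith-u : ∀ K → K + 2 ≡ 0 + 2 * 1 + K
        arith-u = solve-∀
        pays : ∀ x → Dec (x ≡ u) → Dec (x ≡ v) → Dec (x ≡ mu) → Pays A Y B x
        pays x (yes refl) _ _ = settle A Y B x
          (≤-reflexive (weight-busy S Su bu)) (≤-reflexive (cong (_+ 0) (at-≡ u 2)))
          (≤-reflexive (arith-u K)) z≤n (≤-reflexive (≡-sym Yu≡1)) (charge-≥ B (here refl))
        pays x (no x≢u) (yes refl) _ = settle A Y B x
          (weight-free≤4 S Sv fv) (≤-reflexive (charge-absent A (x≢u ∷ [])))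
          (≤-refl {4}) z≤n z≤n (charge-≥ B (there (there (here refl))))
        pays x (no x≢u) (no x≢v) (yes refl) = settle A Y B x
          (≤-reflexive (weight-busy S Smu (busy-mate S Su bu)))
          (≤-reflexive (charge-absent A (x≢u ∷ [])))
          (≤-reflexive (+-identityʳ K)) z≤n z≤n (charge-≥ B (there (here refl)))
        pays x (no x≢u) (no x≢v) (no x≢mu) = persists-pays A Y B x≢u x≢v
          (λ Sx bx → (λ mx≡u → x≢mu (mate-swap mx≡u)) , mate≢free S fv Sx bx)
          (spared x x≢u x≢v x≢mu) (x≢u ∷ [])

      module _ (bv : busy S v ≡ true) where

        mv = mate v

        v≢mv : v ≢ mv
        v≢mv = adj⇒≢ G (busy-adj S bv)

        mv≢u : mv ≢ u
        mv≢u mv≡u = mu≢v (≡-sym (mate-swap mv≡u))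

        mv≢mu : mv ≢ mu
        mv≢mu e = u≢v (≡-sym (mate-injective e))

        Smv : S mv ≡ true
        Smv = busy-alive S bv

        Ymv≡1 : Y mv ≡ 1
        Ymv≡1 = link≡1 Smv (busy-adj S bv)

        weight-mu : weight S' mu ≡ 2 * (deg G S' mu ⊓ 2)
        weight-mu = freed Smu (u≢mu ∘ ≡-sym) mu≢v
          (trans (cong S' (mate-involutive u)) removedˡ)

        weight-mv : weight S' mv ≡ 2 * (deg G S' mv ⊓ 2)
        weight-mv = freed Smv mv≢u (v≢mv ∘ ≡-sym)
          (trans (cong S' (mate-involutive v)) removedʳ)

        both-mated : Charges n
        both-mated = (u , K) ∷ (mu , K) ∷ (v , K) ∷ (mv , K) ∷ []

        -- The refund 8 is 2 + 2 + 4. The link from `u` to `v` gives 2; `mu` gives 2, as remaining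
        -- weight or through a link to `v`; `mv` gives 2 as remaining weight and 2 through its link
        -- to `v`.
        leaf-balance : 1 ≤ deg G S' mu + Y mu → 1 ≤ deg G S' mv →
          (∀ x → x ≢ u → x ≢ v → x ≢ mu → S x ≡ true → Spared (Y x) x) →
          total-weight S + 8 ≤ total-weight S' + 2 * deg G S v + (K + (K + (K + (K + 0))))
        leaf-balance mu-live mv-live spared =
          subst (λ s → total-weight S + total A ≤ total-weight S' + 2 * s + total B) (≡-sym (deg≡sum G S v))
            (balance A B Y (λ x → pays x (x ≟ u) (x ≟ v) (x ≟ mu) (x ≟ mv)))
          where
          A = (u , 2) ∷ (mu , 2) ∷ (mv , 4) ∷ []
          B = both-mated
          arith-u : ∀ K → K + 2 ≡ 0 + 2 * 1 + K
          arith-u = solve-∀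
          arith-mu : ∀ K w y → 2 * (w + y) + K ≡ 2 * w + 2 * y + K
          arith-mu = solve-∀
          arith-mv : ∀ K → K + 4 ≡ 2 + 2 * 1 + K
          arith-mv = solve-∀
          mu-pays : K + 2 ≤ 2 * (deg G S' mu ⊓ 2) + 2 * Y mu + K
          mu-pays = begin
            K + 2                                  ≡⟨ +-comm K 2 ⟩
            2 * 1 + K                              ≤⟨ +-monoˡ-≤ K (*-monoʳ-≤ 2 (⊓-+-≤ {1} {deg G S' mu} mu-live)) ⟩
            2 * (deg G S' mu ⊓ 2 + Y mu) + K       ≡⟨ arith-mu K (deg G S' mu ⊓ 2) (Y mu) ⟩
            2 * (deg G S' mu ⊓ 2) + 2 * Y mu + K   ∎
            where open ≤-Reasoning
          pays : ∀ x → Dec (x ≡ u) → Dec (x ≡ v) → Dec (x ≡ mu) → Dec (x ≡ mv) → Pays A Y B x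
          pays x (yes refl) _ _ _ = settle A Y B x
            (≤-reflexive (weight-busy S Su bu))
            (≤-reflexive (cong₂ _+_ (at-≡ u 2) (charge-absent _ (u≢mu ∷ (mv≢u ∘ ≡-sym) ∷ []))))
            (≤-reflexive (arith-u K)) z≤n (≤-reflexive (≡-sym Yu≡1)) (charge-≥ B (here refl))
          pays x (no x≢u) (yes refl) _ _ = settle A Y B x
            (≤-reflexive (weight-busy S Sv bv))
            (≤-reflexive (charge-absent A (x≢u ∷ (mu≢v ∘ ≡-sym) ∷ v≢mv ∷ [])))
            (≤-reflexive (+-identityʳ K)) z≤n z≤n (charge-≥ B (there (there (here refl))))
          pays x (no x≢u) (no x≢v) (yes refl) _ = settle A Y B x
            (≤-reflexive (weight-busy S Smu (busy-mate S Su bu)))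
            (≤-reflexive (cong₂ _+_ (at-≢ 2 x≢u) (cong₂ _+_ (at-≡ mu 2) (charge-absent _ ((mv≢mu ∘ ≡-sym) ∷ [])))))
            mu-pays (≤-reflexive (≡-sym weight-mu)) ≤-refl (charge-≥ B (there (here refl)))
          pays x (no x≢u) (no x≢v) (no x≢mu) (yes refl) = settle A Y B x
            (≤-reflexive (weight-busy S Smv (busy-mate S Sv bv)))
            (≤-reflexive (cong₂ _+_ (at-≢ 2 x≢u) (cong₂ _+_ (at-≢ 2 x≢mu) (cong (_+ 0) (at-≡ mv 4)))))
            (≤-reflexive (arith-mv K))
            (subst (2 ≤_) (≡-sym weight-mv) (*-monoʳ-≤ 2 (⊓-glb mv-live (s≤s z≤n))))
            (≤-reflexive (≡-sym Ymv≡1)) (charge-≥ B (there (there (there (here refl)))))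
          pays x (no x≢u) (no x≢v) (no x≢mu) (no x≢mv) = persists-pays A Y B x≢u x≢v
            (λ Sx bx → (λ mx≡u → x≢mu (mate-swap mx≡u)) , (λ mx≡v → x≢mv (mate-swap mx≡v)))
            (spared x x≢u x≢v x≢mu) (x≢u ∷ x≢mu ∷ x≢mv ∷ [])

        -- Third vertices lose nothing, so `r` is 0. The freed `mv` still has degree at least 2, and
        -- its remaining weight is the refund of 4.
        leafless-balance : 2 ≤ deg G S' mv →
          (∀ x → x ≢ u → x ≢ v → x ≢ mu → S x ≡ true → Spared 0 x) →
          total-weight S + 4 ≤ total-weight S' + 2 * 0 + (K + (K + (K + (K + 0))))
        leafless-balance mv-safe spared =
          subst (λ s → total-weight S + total A ≤ total-weight S' + 2 * s + total B) (sum-zero n)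
            (balance A B r (λ x → pays x (x ≟ u) (x ≟ v) (x ≟ mu) (x ≟ mv)))
          where
          A = (mv , 4) ∷ []
          B = both-mated
          r : Fin n → ℕ
          r _ = 0
          arith-mv : ∀ K → K + 4 ≡ 4 + 2 * 0 + K
          arith-mv = solve-∀
          pays : ∀ x → Dec (x ≡ u) → Dec (x ≡ v) → Dec (x ≡ mu) → Dec (x ≡ mv) → Pays A r B x
          pays x (yes refl) _ _ _ = settle A r B x
            (≤-reflexive (weight-busy S Su bu))
            (≤-reflexive (charge-absent A ((mv≢u ∘ ≡-sym) ∷ [])))
            (≤-reflexive (+-identityʳ K)) z≤n z≤n (charge-≥ B (here refl))
          pays x (no x≢u) (yes refl) _ _ = settle A r B x
            (≤-reflexive (weight-busy S Sv bv))
            (≤-reflexive (charge-absent A (v≢mv ∷ [])))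
            (≤-reflexive (+-identityʳ K)) z≤n z≤n (charge-≥ B (there (there (here refl))))
          pays x (no x≢u) (no x≢v) (yes refl) _ = settle A r B x
            (≤-reflexive (weight-busy S Smu (busy-mate S Su bu)))
            (≤-reflexive (charge-absent A ((mv≢mu ∘ ≡-sym) ∷ [])))
            (≤-reflexive (+-identityʳ K)) z≤n z≤n (charge-≥ B (there (here refl)))
          pays x (no x≢u) (no x≢v) (no x≢mu) (yes refl) = settle A r B x
            (≤-reflexive (weight-busy S Smv (busy-mate S Sv bv)))
            (≤-reflexive (cong (_+ 0) (at-≡ mv 4)))
            (≤-reflexive (arith-mv K))
            (subst (4 ≤_) (≡-sym weight-mv) (*-monoʳ-≤ 2 (⊓-glb mv-safe ≤-refl)))
            z≤n (charge-≥ B (there (there (there (here refl)))))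
          pays x (no x≢u) (no x≢v) (no x≢mu) (no x≢mv) = persists-pays A r B x≢u x≢v
            (λ Sx bx → (λ mx≡u → x≢mu (mate-swap mx≡u)) , (λ mx≡v → x≢mv (mate-swap mx≡v)))
            (spared x x≢u x≢v x≢mu) (x≢mv ∷ [])

-- Here Δ = 4 + k, so 7 + 2k = 2Δ − 1, 4 + 2k = 2Δ − 4 and 24 + 8k = 2 (4Δ − 4).
module Greedy {n} (G : Graph n) (mate : Fin n → Fin n)
  (mate-involutive : ∀ x → mate (mate x) ≡ x) (k : ℕ) (maxdeg : MaxDegreeAtMost G (4 + k)) where

  open Potential G mate mate-involutive (7 + 2 * k)

  -- The leaf bonus and the potential.

  Leaf : VSet n → Set
  Leaf S = ∃ λ x → S x ≡ true × deg G S x ≡ 1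

  leaf? : ∀ S → Dec (Leaf S)
  leaf? S = any? (λ x → (S x Bool.≟ true) ×-dec (deg G S x ℕ.≟ 1))

  bonus : VSet n → ℕ
  bonus S = if ⌊ leaf? S ⌋ then 4 + 2 * k else 0

  bonus≤ : ∀ S → bonus S ≤ 4 + 2 * k
  bonus≤ S with leaf? S
  ... | yes _ = ≤-refl
  ... | no _  = z≤n

  bonus-leaf : ∀ S → Leaf S → bonus S ≡ 4 + 2 * k
  bonus-leaf S leaf with leaf? S
  ... | yes _    = refl
  ... | no ¬leaf = contradiction leaf ¬leaf

  bonus-leafless : ∀ S → ¬ Leaf S → bonus S ≡ 0
  bonus-leafless S ¬leaf with leaf? S
  ... | yes leaf = contradiction leaf ¬leaf
  ... | no _     = refl

  potential : VSet n → ℕ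
  potential S = total-weight S + bonus S

  deg≤degree : ∀ S x → deg G S x ≤ degree G x
  deg≤degree S x = begin
    deg G S x           ≡⟨ deg≡sum G S x ⟩
    sum (link G S x)    ≤⟨ sum-mono-≤ link≤ ⟩
    sum (link G allV x) ≡⟨ deg≡sum G allV x ⟨
    degree G x          ∎
    where
    open ≤-Reasoning
    link≤ : ∀ w → link G S x w ≤ link G allV x w
    link≤ w with S w
    ... | true  = ≤-refl
    ... | false = z≤n

  -- The cost of a single greedy step, by cases.

  module Step (S : VSet n) {u v : Fin n} (u-min : MinDegNonIsolated G S u)
    (Sv : S v ≡ true) (uv : adj G u v ≡ true) where

    Su : S u ≡ true
    Su = proj₁ u-min

    open Removal S Su Sv uv

    dv≤ : deg G S v ≤ 4 + k
    dv≤ = ≤-trans (deg≤degree S v) (maxdeg v)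

    u-minimal : ∀ {x} → S x ≡ true → 1 ≤ deg G S x → deg G S u ≤ deg G S x
    u-minimal {x} = proj₂ (proj₂ u-min) x

    -- A leaf would be a non-isolated vertex of degree below that of `u`, against minimality.
    leafless : 2 ≤ deg G S u → bonus S ≡ 0
    leafless 2≤d = bonus-leafless S λ (x , Sx , leaf) →
      <⇒≱ 2≤d (subst (deg G S u ≤_) leaf (u-minimal Sx (≤-reflexive (≡-sym leaf))))

    Goal : Set
    Goal = potential S ≤ potential S' + (24 + 8 * k)

    -- The bookkeeping common to all cases: `a` is the refund, `e` bounds the degrees charged, `b`
    -- the bonus that may be lost, and `b'` is the bonus sure to be present afterwards. The unspent
    -- budget `slack` turns the comparison of constants into an identity for the ring solver.
    conclude : ∀ {a s t e b b'} slack → total-weight S + a ≤ total-weight S' + 2 * s + t →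
      s ≤ e → bonus S ≤ b → b' ≤ bonus S' →
      (2 * e + t) + b + slack ≡ (b' + (24 + 8 * k)) + a → Goal
    conclude {a} {s} {t} {e} {b} {b'} slack balanced s≤e bonus≤b b'≤bonus eq =
      +-cancelʳ-≤ a _ _ (begin
        W + bonus S + a                     ≡⟨ swap W (bonus S) a ⟩
        W + a + bonus S                     ≤⟨ +-mono-≤ balanced bonus≤b ⟩
        W' + 2 * s + t + b                  ≤⟨ +-monoˡ-≤ b (+-monoˡ-≤ t (+-monoʳ-≤ W' (*-monoʳ-≤ 2 s≤e))) ⟩
        W' + 2 * e + t + b                  ≤⟨ m≤m+n _ slack ⟩
        W' + 2 * e + t + b + slack          ≡⟨ gather W' e t b slack ⟩
        W' + ((2 * e + t) + b + slack)      ≡⟨ cong (W' +_) eq ⟩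
        W' + ((b' + (24 + 8 * k)) + a)      ≤⟨ +-monoʳ-≤ W' (+-monoˡ-≤ a (+-monoˡ-≤ (24 + 8 * k) b'≤bonus)) ⟩
        W' + ((bonus S' + (24 + 8 * k)) + a) ≡⟨ regroup W' (bonus S') (24 + 8 * k) a ⟩
        W' + bonus S' + (24 + 8 * k) + a    ∎)
      where
      open ≤-Reasoning
      W = total-weight S
      W' = total-weight S'
      swap : ∀ x y z → x + y + z ≡ x + z + y
      swap = solve-∀
      gather : ∀ w e t b c → w + 2 * e + t + b + c ≡ w + ((2 * e + t) + b + c)
      gather = solve-∀
      regroup : ∀ w x y z → w + ((x + y) + z) ≡ w + x + y + z
      regroup = solve-∀

    isolated-or-≥ : ∀ {x} → S x ≡ true → deg G S x ≡ 0 ⊎ deg G S u ≤ deg G S x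
    isolated-or-≥ {x} Sx with deg G S x in dx
    ... | zero  = inj₁ refl
    ... | suc d = inj₂ (subst (deg G S u ≤_) dx (u-minimal Sx (subst (1 ≤_) (≡-sym dx) (s≤s z≤n))))

    link≤1 : ∀ a x → link G S a x ≤ 1
    link≤1 a x with S x ∧ adj G a x
    ... | true  = ≤-refl
    ... | false = z≤n

    -- `v` already accounts for one edge of `u`, so a link to another vertex comes on top.
    X-else : ∀ {x} → x ≢ v → 1 + X x ≤ deg G S u
    X-else {x} x≢v = subst (_≤ deg G S u) (cong₂ _+_ Xv≡1 (+-identityʳ (X x)))
      (links≤deg G S u (v ∷ x ∷ []) (((x≢v ∘ ≡-sym) ∷ []) ∷ [] ∷ []))

    -- Counts the edges of `x` that do not lead to `u`: each survives the step or leads to `v`.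
    stays-≥2 : ∀ {x} → S x ≡ true → 2 + X x ≤ deg G S x → 2 ≤ deg G S' x + Y x
    stays-≥2 {x} Sx 2+X≤ = +-cancelʳ-≤ (X x) 2 _ (begin
      2 + X x                        ≤⟨ 2+X≤ ⟩
      deg G S x                      ≡⟨ deg-kept Sx ⟩
      deg G S' x + (X x + Y x)       ≡⟨ rotate (deg G S' x) (X x) (Y x) ⟩
      deg G S' x + Y x + X x         ∎)
      where
      open ≤-Reasoning
      rotate : ∀ d a b → d + (a + b) ≡ d + b + a
      rotate = solve-∀

    -- With two edges besides a possible one to `u`, truncation hides the loss of the latter, and
    -- only the link to `v` has to be charged. An isolated vertex has nothing to lose.
    spared-≥2 : ∀ b {x} → S x ≡ true → Y x ≤ b → deg G S x ≡ 0 ⊎ 2 + X x ≤ deg G S x → Spared b x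
    spared-≥2 b {x} Sx Y≤b (inj₁ isolated) = subst (λ d → d ⊓ 2 ≤ deg G S' x ⊓ 2 + b) (≡-sym isolated) z≤n
    spared-≥2 b {x} Sx Y≤b (inj₂ 2+X≤)    = spare b (≤-trans (m⊓n≤n (deg G S x) 2)
      (≤-trans (stays-≥2 Sx 2+X≤) (+-monoʳ-≤ (deg G S' x) Y≤b)))

    -- The only edge of `u` leads to `v`, so another vertex can lose at most its edge to `v`.
    spared-deg1 : deg G S u ≡ 1 → ∀ x → x ≢ u → x ≢ v → S x ≡ true → Spared (Y x + 0 * X x) x
    spared-deg1 d≡1 x x≢u x≢v Sx = spare (Y x + 0) (≤-trans (m⊓n≤m (deg G S x) 2) (≤-reflexive (begin
      deg G S x                ≡⟨ deg-kept Sx ⟩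
      deg G S' x + (X x + Y x) ≡⟨ cong (λ e → deg G S' x + (e + Y x)) X≡0 ⟩
      deg G S' x + Y x         ≡⟨ cong (deg G S' x +_) (+-identityʳ (Y x)) ⟨
      deg G S' x + (Y x + 0)   ∎)))
      where
      open ≡-Reasoning
      X≡0 : X x ≡ 0
      X≡0 = n≤0⇒n≡0 (s≤s⁻¹ (subst (1 + X x ≤_) d≡1 (X-else x≢v)))

    -- When `u` has degree 2, a vertex adjacent to both `u` and `v` may drop from degree 2 to 0, so
    -- links to `u` are charged as well as links to `v`.
    spared-deg2 : ∀ x → x ≢ u → x ≢ v → S x ≡ true → Spared (Y x + 1 * X x) x
    spared-deg2 x x≢u x≢v Sx = spare (Y x + 1 * X x) (≤-trans (m⊓n≤m (deg G S x) 2) (≤-reflexive (begin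
      deg G S x                    ≡⟨ deg-kept Sx ⟩
      deg G S' x + (X x + Y x)     ≡⟨ cong (deg G S' x +_) (+-comm (X x) (Y x)) ⟩
      deg G S' x + (Y x + X x)     ≡⟨ cong (λ e → deg G S' x + (Y x + e)) (*-identityˡ (X x)) ⟨
      deg G S' x + (Y x + 1 * X x) ∎)))
      where open ≡-Reasoning

    -- By minimality a non-isolated vertex has at least three edges and keeps two after losing one
    -- to `u`, so only the edge to `v` is charged.
    spared-deg3 : 3 ≤ deg G S u → ∀ x → x ≢ u → x ≢ v → S x ≡ true → Spared (Y x + 0 * X x) x
    spared-deg3 3≤d x x≢u x≢v Sx = spared-≥2 (Y x + 0) Sx (m≤m+n (Y x) 0) (Sum.map₂ large (isolated-or-≥ Sx))
      where
      large : deg G S u ≤ deg G S x → 2 + X x ≤ deg G S x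
      large d≤ = ≤-trans (+-monoʳ-≤ 2 (link≤1 u x)) (≤-trans 3≤d d≤)

    -- Degree 1 is tight, as the whole bonus may vanish. From degree 2 on there is no bonus to lose;
    -- degree 2 adds the two links of `u` to the charge.
    v-mated-goal : ∀ d → deg G S u ≡ d → (busy S u ≡ true → mate u ≡ v) → busy S v ≡ true → Goal
    v-mated-goal 0 d≡ _ _ = contradiction (subst (1 ≤_) d≡ (proj₁ (proj₂ u-min))) λ ()
    v-mated-goal 1 d≡ h bv = conclude 0
      (v-mated-balance 0 0 h bv (subst (λ d → 2 * (d ⊓ 2) ≤ 2) (≡-sym d≡) ≤-refl) (spared-deg1 d≡))
      (+-monoˡ-≤ 0 dv≤) (bonus≤ S) z≤n (arith k)
      where
      arith : ∀ k → 2 * (4 + k + 0) + (0 + ((7 + 2 * k) + ((7 + 2 * k) + 0))) + (4 + 2 * k) + 0 ≡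
        0 + (24 + 8 * k) + 2
      arith = solve-∀
    v-mated-goal 2 d≡ h bv = conclude (2 * k)
      (v-mated-balance 1 2 h bv (*-monoʳ-≤ 2 (m⊓n≤n (deg G S u) 2)) spared-deg2)
      (+-mono-≤ dv≤ (≤-reflexive (cong (1 *_) d≡))) (≤-reflexive (leafless (≤-reflexive (≡-sym d≡)))) z≤n (arith k)
      where
      arith : ∀ k → 2 * (4 + k + 1 * 2) + (2 + ((7 + 2 * k) + ((7 + 2 * k) + 0))) + 0 + 2 * k ≡
        0 + (24 + 8 * k) + 4
      arith = solve-∀
    v-mated-goal (suc (suc (suc d))) d≡ h bv = conclude (2 + 2 * k)
      (v-mated-balance 0 2 h bv (*-monoʳ-≤ 2 (m⊓n≤n (deg G S u) 2)) (spared-deg3 3≤d))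
      (+-monoˡ-≤ 0 dv≤) (≤-reflexive (leafless (<⇒≤ 3≤d))) z≤n (arith k)
      where
      3≤d : 3 ≤ deg G S u
      3≤d = subst (3 ≤_) (≡-sym d≡) (s≤s (s≤s (s≤s z≤n)))
      arith : ∀ k → 2 * (4 + k + 0) + (2 + ((7 + 2 * k) + ((7 + 2 * k) + 0))) + 0 + (2 + 2 * k) ≡
        0 + (24 + 8 * k) + 2
      arith = solve-∀

    unmated-goal : ∀ d → deg G S u ≡ d → busy S u ≡ false → busy S v ≡ false → Goal
    unmated-goal 0 d≡ _ _ = contradiction (subst (1 ≤_) d≡ (proj₁ (proj₂ u-min))) λ ()
    unmated-goal 1 d≡ fu fv = conclude (4 + 4 * k) (unmated-balance 0 fu fv (spared-deg1 d≡))
      (+-monoˡ-≤ 0 dv≤) (bonus≤ S) z≤n (arith k)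
      where
      arith : ∀ k → 2 * (4 + k + 0) + 8 + (4 + 2 * k) + (4 + 4 * k) ≡ 0 + (24 + 8 * k) + 0
      arith = solve-∀
    unmated-goal 2 d≡ fu fv = conclude (4 + 6 * k) (unmated-balance 1 fu fv spared-deg2)
      (+-mono-≤ dv≤ (≤-reflexive (cong (1 *_) d≡))) (≤-reflexive (leafless (≤-reflexive (≡-sym d≡)))) z≤n (arith k)
      where
      arith : ∀ k → 2 * (4 + k + 1 * 2) + 8 + 0 + (4 + 6 * k) ≡ 0 + (24 + 8 * k) + 0
      arith = solve-∀
    unmated-goal (suc (suc (suc d))) d≡ fu fv = conclude (8 + 6 * k) (unmated-balance 0 fu fv (spared-deg3 3≤d))
      (+-monoˡ-≤ 0 dv≤) (≤-reflexive (leafless (<⇒≤ 3≤d))) z≤n (arith k)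
      where
      3≤d : 3 ≤ deg G S u
      3≤d = subst (3 ≤_) (≡-sym d≡) (s≤s (s≤s (s≤s z≤n)))
      arith : ∀ k → 2 * (4 + k + 0) + 8 + 0 + (8 + 6 * k) ≡ 0 + (24 + 8 * k) + 0
      arith = solve-∀

    module _ (bu : busy S u ≡ true) (mu≢v : mate u ≢ v) where

      m = mu bu mu≢v

      Xm≡1 : X m ≡ 1
      Xm≡1 = Xmu≡1 bu mu≢v

      2≤du : 2 ≤ deg G S u
      2≤du = subst (λ e → 1 + e ≤ deg G S u) Xm≡1 (X-else mu≢v)

      -- If x is a third neighbour of u, then u, and hence x, has degree at least 3.
      roomy : ∀ {x} → x ≢ v → x ≢ m → S x ≡ true → 1 ≤ deg G S x → 2 + X x ≤ deg G S x
      roomy {x} x≢v x≢m Sx 1≤dx = ≤-trans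
        (subst (_≤ deg G S u) (cong₂ _+_ Xv≡1 (cong₂ _+_ Xm≡1 (+-identityʳ (X x))))
          (links≤deg G S u (v ∷ m ∷ x ∷ [])
            (((mu≢v ∘ ≡-sym) ∷ (x≢v ∘ ≡-sym) ∷ []) ∷ ((x≢m ∘ ≡-sym) ∷ []) ∷ [] ∷ [])))
        (u-minimal Sx 1≤dx)

      isolated-or-roomy : ∀ {x} → x ≢ v → x ≢ m → S x ≡ true → deg G S x ≡ 0 ⊎ 2 + X x ≤ deg G S x
      isolated-or-roomy x≢v x≢m Sx =
        Sum.map₂ (λ d≤ → roomy x≢v x≢m Sx (≤-trans (proj₁ (proj₂ u-min)) d≤)) (isolated-or-≥ Sx)

      spared-roomy : ∀ x → x ≢ u → x ≢ v → x ≢ m → S x ≡ true → Spared (Y x) x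
      spared-roomy x _ x≢v x≢m Sx = spared-≥2 (Y x) Sx ≤-refl (isolated-or-roomy x≢v x≢m Sx)

      u-mated-goal : busy S v ≡ false → Goal
      u-mated-goal fv = conclude (2 * k) (u-mated-balance bu mu≢v fv spared-roomy)
        dv≤ (≤-reflexive (leafless 2≤du)) z≤n (arith k)
        where
        arith : ∀ k → 2 * (4 + k) + ((7 + 2 * k) + ((7 + 2 * k) + 4)) + 0 + 2 * k ≡ 0 + (24 + 8 * k) + 2
        arith = solve-∀

      -- At most one of the two edges that avoid `u` leads to `v`, so another remains.
      survives : ∀ {x} → S x ≡ true → 2 + X x ≤ deg G S x → 1 ≤ deg G S' x
      survives {x} Sx 2+X≤ = +-cancelʳ-≤ 1 1 _ (≤-trans (stays-≥2 Sx 2+X≤) (+-monoʳ-≤ (deg G S' x) (link≤1 v x)))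

      both-mated-goal : busy S v ≡ true → Goal
      both-mated-goal bv = by-leaf (leaf? S')
        where
        p = mv bu mu≢v bv
        Sm = Smu bu mu≢v
        Sp = Smv bu mu≢v bv
        p≢v = v≢mv bu mu≢v bv ∘ ≡-sym
        Yp≡1 = Ymv≡1 bu mu≢v bv

        1≤dp : 1 ≤ deg G S p
        1≤dp = subst (1 ≤_) (≡-sym (deg-kept Sp))
          (≤-trans (≤-reflexive (≡-sym Yp≡1)) (≤-trans (m≤n+m (Y p) (X p)) (m≤n+m _ (deg G S' p))))

        p-survives : 1 ≤ deg G S' p
        p-survives = survives Sp (roomy p≢v (mv≢mu bu mu≢v bv) Sp 1≤dp)

        m-live : 1 ≤ deg G S' m + Y m
        -- By minimality `m` has degree at least 2; besides its edge to `u` it has another, which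
        -- survives or leads to `v`.
        m-live = +-cancelʳ-≤ 1 1 _ (begin
          2                              ≤⟨ 2≤du ⟩
          deg G S u                      ≤⟨ u-minimal Sm 1≤dm ⟩
          deg G S m                      ≡⟨ deg-kept Sm ⟩
          deg G S' m + (X m + Y m)       ≡⟨ cong (λ e → deg G S' m + (e + Y m)) Xm≡1 ⟩
          deg G S' m + (1 + Y m)         ≡⟨ rotate (deg G S' m) (Y m) ⟩
          deg G S' m + Y m + 1           ∎)
          where
          open ≤-Reasoning
          rotate : ∀ d b → d + (1 + b) ≡ d + b + 1
          rotate = solve-∀
          1≤dm : 1 ≤ deg G S m
          1≤dm = subst (1 ≤_) (≡-sym (deg-kept Sm))
            (≤-trans (≤-reflexive (≡-sym Xm≡1)) (≤-trans (m≤m+n (X m) (Y m)) (m≤n+m _ (deg G S' m))))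

        by-leaf : Dec (Leaf S') → Goal
        -- The drops cost at most `2 * (4 + k)`. The new bonus covers all but 4 of this, and the
        -- refund of 8 instead of 4 covers the rest.
        by-leaf (yes leaf) = conclude 0 (leaf-balance bu mu≢v bv m-live p-survives spared-roomy)
          dv≤ (≤-reflexive (leafless 2≤du)) (≤-reflexive (≡-sym (bonus-leaf S' leaf))) (arith k)
          where
          arith : ∀ k → 2 * (4 + k) + ((7 + 2 * k) + ((7 + 2 * k) + ((7 + 2 * k) + ((7 + 2 * k) + 0)))) + 0 + 0 ≡
            (4 + 2 * k) + (24 + 8 * k) + 8
          arith = solve-∀
        -- Without leaves every non-isolated vertex of `S'` has degree at least 2, so a vertex that
        -- keeps an edge keeps truncated degree 2.
        by-leaf (no ¬leaf) = conclude 0 (leafless-balance bu mu≢v bv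
            (safe (mv≢u bu mu≢v bv) p≢v Sp p-survives) spared)
          (≤-refl {0}) (≤-reflexive (leafless 2≤du)) z≤n (arith k)
          where
          arith : ∀ k → 2 * 0 + ((7 + 2 * k) + ((7 + 2 * k) + ((7 + 2 * k) + ((7 + 2 * k) + 0)))) + 0 + 0 ≡
            0 + (24 + 8 * k) + 4
          arith = solve-∀
          safe : ∀ {x} → x ≢ u → x ≢ v → S x ≡ true → 1 ≤ deg G S' x → 2 ≤ deg G S' x
          safe {x} x≢u x≢v Sx 1≤d = ≤∧≢⇒< 1≤d λ 1≡d → ¬leaf (x , trans (kept x≢u x≢v) Sx , ≡-sym 1≡d)
          spared : ∀ x → x ≢ u → x ≢ v → x ≢ m → S x ≡ true → Spared 0 x
          spared x x≢u x≢v x≢m Sx with isolated-or-roomy x≢v x≢m Sx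
          ... | inj₁ isolated = subst (λ d → d ⊓ 2 ≤ deg G S' x ⊓ 2 + 0) (≡-sym isolated) z≤n
          ... | inj₂ 2+X≤     = spare 0 (≤-trans (m⊓n≤n (deg G S x) 2)
            (≤-trans (safe x≢u x≢v Sx (survives Sx 2+X≤)) (m≤m+n _ 0)))

    goal : Goal
    goal = by-cases (busy S u) (busy S v) refl refl
      where
      mated : busy S u ≡ true → Dec (mate u ≡ v) → ∀ b → busy S v ≡ b → Goal
      mated bu (yes mu≡v) true  bv = v-mated-goal (deg G S u) refl (λ _ → mu≡v) bv
      mated bu (yes mu≡v) false fv = contradiction mu≡v (mate≢free S fv Su bu)
      mated bu (no mu≢v)  true  bv = both-mated-goal bu mu≢v bv
      mated bu (no mu≢v)  false fv = u-mated-goal bu mu≢v fv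
      by-cases : ∀ a b → busy S u ≡ a → busy S v ≡ b → Goal
      by-cases true  b     bu ev = mated bu (mate u ≟ v) b ev
      by-cases false true  fu bv =
        v-mated-goal (deg G S u) refl (λ bu → contradiction (trans (≡-sym bu) fu) λ ()) bv
      by-cases false false fu fv = unmated-goal (deg G S u) refl fu fv

  -- Edgeless graphs, whole runs and the final inequality.

  edgeless-deg : ∀ S → ¬ HasEdge G S → ∀ {x} → S x ≡ true → deg G S x ≡ 0
  edgeless-deg S ¬edge {x} Sx = trans (deg≡sum G S x) (trans (sum-cong-≗ no-link) (sum-zero n))
    where
    no-link : ∀ w → link G S x w ≡ 0
    no-link w with S w in Sw | adj G x w in xw
    ... | false | _     = refl
    ... | true  | false = refl
    ... | true  | true  = contradiction (x , w , Sx , Sw , xw) ¬edge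

  -- A present busy vertex and its mate would span an edge, and a leaf would have one; what remains
  -- are free vertices of degree 0.
  edgeless-potential : ∀ S → ¬ HasEdge G S → potential S ≡ 0
  edgeless-potential S ¬edge = cong₂ _+_
    (trans (sum-cong-≗ (λ x → weightless x (S x) (busy S x) refl refl)) (sum-zero n))
    (bonus-leafless S λ (x , Sx , leaf) → contradiction (trans (≡-sym leaf) (edgeless-deg S ¬edge Sx)) λ ())
    where
    weightless : ∀ x s b → S x ≡ s → busy S x ≡ b → weight S x ≡ 0
    weightless x false _     Sx _  = weight-out S Sx
    weightless x true  true  Sx bx = contradiction (x , mate x , Sx , busy-alive S bx , busy-adj S bx) ¬edge
    weightless x true  false Sx fx =
      trans (weight-free S Sx fx) (cong (λ d → 2 * (d ⊓ 2)) (edgeless-deg S ¬edge Sx))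

  potential≤run : ∀ {S M} → MinGreedyRun G S M → potential S ≤ length M * (24 + 8 * k)
  potential≤run (stop {S} ¬edge) = ≤-reflexive (edgeless-potential S ¬edge)
  potential≤run (step {S} {M} u v u-min Sv uv run) = begin
    potential S                                    ≤⟨ Step.goal S u-min Sv uv ⟩
    potential (remove S u v) + (24 + 8 * k)        ≤⟨ +-monoˡ-≤ (24 + 8 * k) (potential≤run run) ⟩
    length M * (24 + 8 * k) + (24 + 8 * k)         ≡⟨ +-comm (length M * (24 + 8 * k)) _ ⟩
    (24 + 8 * k) + length M * (24 + 8 * k)         ∎
    where open ≤-Reasoning

  -- With all vertices present, those adjacent to their mates are busy and weigh `7 + 2 * k`; the
  -- other weights and the bonus are dropped.
  mated≤potential : (7 + 2 * k) * sum (λ x → bit (adj G x (mate x))) ≤ potential allV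
  mated≤potential = begin
    (7 + 2 * k) * sum (λ x → bit (adj G x (mate x)))   ≡⟨ *-distribˡ-sum (7 + 2 * k) (λ x → bit (adj G x (mate x))) ⟩
    sum (λ x → (7 + 2 * k) * bit (adj G x (mate x)))   ≤⟨ sum-mono-≤ mated≤weight ⟩
    total-weight allV                                  ≤⟨ m≤m+n (total-weight allV) (bonus allV) ⟩
    potential allV                                     ∎
    where
    open ≤-Reasoning
    mated≤weight : ∀ x → (7 + 2 * k) * bit (adj G x (mate x)) ≤ weight allV x
    mated≤weight x with adj G x (mate x)
    ... | true  = ≤-reflexive (*-identityʳ (7 + 2 * k))
    ... | false = ≤-trans (≤-reflexive (*-zeroʳ (7 + 2 * k))) z≤n

theorem4 : (Δ : ℕ) → 4 ≤ Δ → (n : ℕ) → (G : Graph n) → MaxDegreeAtMost G Δ →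
    (ν : ℕ) → IsMatchingNumber G ν →
    (M : List (Fin n × Fin n)) → MinGreedyRun G allV M →
    (2 * Δ ∸ 1) * ν ≤ (4 * Δ ∸ 4) * length M
theorem4 Δ 4≤Δ n G maxdeg ν ((N , matching@(_ , disjoint) , |N|≡ν) , _) M run with m≤n⇒∃[o]m+o≡n 4≤Δ
-- Everything is doubled because an edge of `N` has two endpoints: it contributes `2 * (7 + 2 * k)`
-- to the potential, while a step spends at most `2 * (12 + 4 * k)`.
... | k , refl = *-cancelˡ-≤ 2 (begin
  2 * ((2 * (4 + k) ∸ 1) * ν)           ≡⟨ cong (λ c → 2 * (c * ν)) (coefficientˡ k) ⟩
  2 * ((7 + 2 * k) * ν)                 ≡⟨ double k ν ⟩
  (7 + 2 * k) * (ν * 2)                 ≡⟨ cong (λ l → (7 + 2 * k) * (l * 2)) |N|≡ν ⟨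
  (7 + 2 * k) * (length N * 2)          ≤⟨ *-monoʳ-≤ (7 + 2 * k) (matching≤mated G N matching) ⟩
  (7 + 2 * k) * sum (λ x → bit (adj G x (mateIn N x))) ≤⟨ mated≤potential ⟩
  potential allV                        ≤⟨ potential≤run run ⟩
  length M * (24 + 8 * k)               ≡⟨ halve k (length M) ⟩
  2 * ((12 + 4 * k) * length M)         ≡⟨ cong (λ c → 2 * (c * length M)) (coefficientʳ k) ⟨
  2 * ((4 * (4 + k) ∸ 4) * length M)    ∎)
  where
  open ≤-Reasoning
  open Greedy G (mateIn N) (mateIn-involutive N disjoint) k maxdeg
  double : ∀ k ν → 2 * ((7 + 2 * k) * ν) ≡ (7 + 2 * k) * (ν * 2)
  double = solve-∀
  halve : ∀ k m → m * (24 + 8 * k) ≡ 2 * ((12 + 4 * k) * m)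
  halve = solve-∀
  coefficientˡ : ∀ k → 2 * (4 + k) ∸ 1 ≡ 7 + 2 * k
  coefficientˡ k = cong (_∸ 1) (expand k)
    where
    expand : ∀ k → 2 * (4 + k) ≡ 8 + 2 * k
    expand = solve-∀
  coefficientʳ : ∀ k → 4 * (4 + k) ∸ 4 ≡ 12 + 4 * k
  coefficientʳ k = cong (_∸ 4) (expand k)
    where
    expand : ∀ k → 4 * (4 + k) ≡ 16 + 4 * k
    expand = solve-∀
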